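{- Let $\sigma$ be a permutation of length two or more. Then $\sigma$ is not effective if and only if $\hat{\sigma}=1\oplus\alpha$ for some $\alpha\in\mathrm{Sym}(231)$.
   Context: $\mathrm{Sym}_n$ is the set of permutations of $\{1,\dots,n\}$ in one-line notation and $\mathrm{Sym}=\bigcup_{n\ge 1}\mathrm{Sym}_n$. A sequence of distinct numbers contains a permutation $\tau$ of length $k$ if it has a (not necessarily contiguous) subsequence of length $k$ that is order isomorphic to $\tau$; otherwise it avoids $\tau$. $\mathrm{Sym}(\tau)$ denotes the set of permutations in $\mathrm{Sym}$ avoiding $\tau$. For $\sigma=\sigma_1\sigma_2\sigma_3\cdots\sigma_k$ with $k\ge2$, $\hat\sigma=\sigma_2\sigma_1\sigma_3\cdots\sigma_k$ (interchange the first two entries). For a permutation $\alpha=\alpha_1\cdots\alpha_m$, $1\oplus\alpha$ is the permutation $1(\alpha_1+1)\cdots(\alpha_m+1)$ of length $m+1$. For a permutation $\tau$ of length at least two, the $\tau$-stack operator $\mathcal{S}^{\tau}:\mathrm{Sym}\to\mathrm{Sym}$ sends $\pi$ to the output of the following greedy process, starting with an empty stack and an empty output. While there are unread entries of $\pi$ (read from left to right): if pushing the next entry on top of the stack yields stack content that, read from top to bottom, avoids $\tau$, push it; otherwise pop the top entry of the stack and append it to the right end of the output. When all entries of $\pi$ have been read, pop all remaining entries of the stack one by one, appending them to the output. A permutation $\pi\in\mathrm{Sym}_n$ is $\sigma$-sortable if $(\mathcal{S}^{21}\circ\mathcal{S}^{\sigma})(\pi)=12\cdots n$; $\mathrm{Sort}(\sigma)$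 is the set of $\sigma$-sortable permutations. The set of $\sigma$-sorted permutations is $\mathrm{Sorted}(\sigma)=\mathcal{S}^{\sigma}(\mathrm{Sort}(\sigma))$. The permutation $\sigma$ is effective if $\mathrm{Sorted}(\sigma)\subseteq\mathrm{Sym}(\sigma)$. -}

module Defs where

open import Data.Bool using (if_then_else_)
open import Data.Fin using (cast)
open import Data.Fin.Properties using (all?)
open import Data.List using (List; []; _∷_; length; lookup; map; upTo)
open import Data.List.Relation.Binary.Permutation.Propositional using (_↭_)
open import Data.List.Relation.Binary.Sublist.Propositional
  using ([]; _∷_; _∷ʳ_) renaming (_⊆_ to _⊑_)
open import Data.Nat using (ℕ; suc; _≤_; _<_; _<?_; _≟_)
open import Data.Product using (Σ-syntax; ∃-syntax; _×_; _,_)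
open import Data.Sum using (_⊎_; inj₁; inj₂)
open import Function using (_∘_; _⇔_; mk⇔; Equivalence)
open import Level using (0ℓ)
open import Relation.Binary.PropositionalEquality using (_≡_; refl)
open import Relation.Nullary using (¬_; Dec; yes; no; does; ¬?; _×-dec_; _→-dec_; _⊎-dec_)
import Relation.Nullary.Decidable as Dec
open import Relation.Unary using (Pred; Decidable; _∈_; _⊆_)

identity : ℕ → List ℕ
identity n = map suc (upTo n)

Symₙ : ℕ → Pred (List ℕ) 0ℓ
Symₙ n π = π ↭ identity n

Sym : Pred (List ℕ) 0ℓ
Sym π = ∃[ n ] 1 ≤ n × π ∈ Symₙ n

OrderIsomorphic : List ℕ → List ℕ → Set
OrderIsomorphic xs ys =
  Σ[ eq ∈ length xs ≡ length ys ]
    (∀ i j → lookup xs i < lookup xs j ⇔ lookup ys (cast eq i) < lookup ys (cast eq j))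

_Contains_ : List ℕ → List ℕ → Set
xs Contains τ = ∃[ ys ] ys ⊑ xs × OrderIsomorphic ys τ

_Avoids_ : List ℕ → List ℕ → Set
xs Avoids τ = ¬ (xs Contains τ)

Sym⟨_⟩ : List ℕ → Pred (List ℕ) 0ℓ
Sym⟨ τ ⟩ π = π ∈ Sym × π Avoids τ

orderIsomorphic? : ∀ xs ys → Dec (OrderIsomorphic xs ys)
orderIsomorphic? xs ys with length xs ≟ length ys
... | no ≢  = no λ (eq , _) → ≢ eq
... | yes eq = Dec.map′ (eq ,_) (λ (_ , iso) → iso)
  (all? λ i → all? λ j →
    let p? = lookup xs i <? lookup xs j
        q? = lookup ys (cast eq i) <? lookup ys (cast eq j)
    in Dec.map′ (λ (f , g) → mk⇔ f g) (λ e → Equivalence.to e , Equivalence.from e)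
         ((p? →-dec q?) ×-dec (q? →-dec p?)))

anySublist? : {P : Pred (List ℕ) 0ℓ} → Decidable P → ∀ xs → Dec (∃[ ys ] ys ⊑ xs × P ys)
anySublist? P? [] = Dec.map′ (λ p → [] , [] , p) (λ { (_ , [] , p) → p }) (P? [])
anySublist? {P} P? (x ∷ xs) =
  Dec.map′ to from (anySublist? P? xs ⊎-dec anySublist? (P? ∘ (x ∷_)) xs)
  where
  to : (∃[ ys ] ys ⊑ xs × P ys) ⊎ (∃[ ys ] ys ⊑ xs × P (x ∷ ys)) →
       ∃[ ys ] ys ⊑ (x ∷ xs) × P ys
  to (inj₁ (ys , s , p)) = ys , x ∷ʳ s , p
  to (inj₂ (ys , s , p)) = x ∷ ys , refl ∷ s , p
  from : (∃[ ys ] ys ⊑ (x ∷ xs) × P ys) →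
         (∃[ ys ] ys ⊑ xs × P ys) ⊎ (∃[ ys ] ys ⊑ xs × P (x ∷ ys))
  from (ys , _ ∷ʳ s , p)           = inj₁ (ys , s , p)
  from (_ ∷ ys , refl ∷ s , p)     = inj₂ (ys , s , p)

avoids? : ∀ xs τ → Dec (xs Avoids τ)
avoids? xs τ = ¬? (anySublist? (λ ys → orderIsomorphic? ys τ) xs)

-- `run τ input stack` is the output still to be produced from the given state;
-- the head of `stack` is its top.  On an empty stack the next entry is pushed
-- without a test, since a single entry avoids every τ of length at least two
-- (for shorter τ the operator has no meaning).
run : List ℕ → List ℕ → List ℕ → List ℕ
run τ []      stack   = stack
run τ (x ∷ π) []      = run τ π (x ∷ [])
run τ (x ∷ π) (s ∷ stack) =
  if does (avoids? (x ∷ s ∷ stack) τ)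
  then run τ π (x ∷ s ∷ stack)
  else s ∷ run τ (x ∷ π) stack

𝒮 : List ℕ → List ℕ → List ℕ
𝒮 τ π = run τ π []

Sort : List ℕ → Pred (List ℕ) 0ℓ
Sort σ π = ∃[ n ] 1 ≤ n × π ∈ Symₙ n × (𝒮 (2 ∷ 1 ∷ []) ∘ 𝒮 σ) π ≡ identity n

Sorted : List ℕ → Pred (List ℕ) 0ℓ
Sorted σ ρ = ∃[ π ] π ∈ Sort σ × ρ ≡ 𝒮 σ π

Effective : List ℕ → Set
Effective σ = Sorted σ ⊆ Sym⟨ σ ⟩

-- Only meaningful for length at least two; shorter lists are left unchanged.
hat : List ℕ → List ℕ
hat (a ∷ b ∷ σ) = b ∷ a ∷ σ
hat σ           = σ

1⊕_ : List ℕ → List ℕ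
1⊕ α = 1 ∷ map suc α

{-# OPTIONS --safe #-}

-- By Knuth, σ-sorted permutations are the 231-avoiding outputs ρ of the σ-stack.
-- Any pop made before the input is exhausted leaves an occurrence of σ̂ in ρ, so
-- a ρ containing σ contains σ̂ as well.  If 1 comes third or later in σ, then σ
-- or σ̂ contains 231.  If σ starts with 1, the entry x blocking the first entry
-- s of an occurrence of σ in ρ is below s, and x either completes a 231 or
-- replaces s in an occurrence that comes later.  If 1 is second, σ has to avoid
-- 231, i.e. σ = a 1 L H with L < a < H, and with d = a - 1 the σ-stack can
-- output (a 1 L) followed by (a L H) + d, which avoids 231 and contains σ.
module Submission where

open import Defs
open import Data.Bool using (if_then_else_)
open import Data.Empty using (⊥; ⊥-elim)
open import Data.Fin using (Fin; zero; suc; cast)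
open import Data.Fin.Properties using (any?; cast-involutive)
open import Data.List
  using (List; []; _∷_; _++_; _ʳ++_; applyUpTo; filter; length; lookup; map; upTo)
open import Data.List.Membership.Propositional using () renaming (_∈_ to _∈ₗ_)
open import Data.List.Membership.Propositional.Properties
  using (∈-++⁺ˡ; ∈-lookup; ∈-map⁺)
open import Data.List.Properties
open import Data.List.Relation.Binary.Permutation.Propositional
  using (_↭_; ↭-refl; ↭-reflexive; ↭-sym; ↭-trans; ↭⇒↭ₛ; prep; swap; module PermutationReasoning)
open import Data.List.Relation.Binary.Permutation.Propositional.Properties
  using (All-resp-↭; drop-∷; filter-↭; shift; ↭-length; ∈-resp-↭)
  renaming (map⁺ to ↭-map⁺; ++⁺ to ↭-++⁺; ++⁺ˡ to ↭-++⁺ˡ)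
import Data.List.Relation.Binary.Permutation.Setoid.Properties as Permutationₛ
open import Data.List.Relation.Binary.Pointwise using (Pointwise-≡⇒≡)
open import Data.List.Relation.Binary.Sublist.Propositional
  using ([]; _∷_; _∷ʳ_; from∈; to∈; ⊆-refl; ⊆-reflexive; ⊆-trans)
  renaming (_⊆_ to _⊑_; lookup to ⊑-lookup)
open import Data.List.Relation.Binary.Sublist.Propositional.Properties
  using (All-resp-⊆; length-mono-≤; ∷ˡ⁻)
  renaming (map⁺ to ⊑-map⁺; ++⁺ to ⊑-++⁺; ++⁺ˡ to ⊑-++⁺ˡ; ++⁺ʳ to ⊑-++⁺ʳ)
open import Data.List.Relation.Unary.All as All using (All; []; _∷_)
import Data.List.Relation.Unary.All.Properties as All
open import Data.List.Relation.Unary.AllPairs as AllPairs using (AllPairs; []; _∷_)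
import Data.List.Relation.Unary.AllPairs.Properties as AllPairs
open import Data.List.Relation.Unary.Any using (here; there; index)
open import Data.List.Relation.Unary.Any.Properties using (lookup-index)
open import Data.List.Relation.Unary.Sorted.TotalOrder.Properties using (AllPairs⇒Sorted; ↗↭↗⇒≋)
open import Data.Nat
  using (ℕ; suc; zero; pred; _+_; _∸_; _≤_; _<_; _≤?_; _<?_; _≟_; s<s⁻¹; s≤s; z<s; z≤n; >-nonZero)
open import Data.Nat.Properties
open import Data.Product using (Σ-syntax; ∃-syntax; ∃₂; _×_; _,_; proj₂)
open import Data.Sum using (_⊎_; inj₁; inj₂; [_,_]′)
open import Function using (_∘_; id; _⇔_; mk⇔; Equivalence)
open import Relation.Binary.Definitions using (tri<; tri≈; tri>)
open import Relation.Binary.PropositionalEquality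
  using (_≡_; _≢_; refl; sym; trans; cong; cong₂; subst; subst₂; ≢-sym; setoid; module ≡-Reasoning)
open import Relation.Nullary using (¬_; does; yes; no; contradiction)
open import Relation.Nullary.Decidable using (dec-false; dec-true; decidable-stable; toSum)
open import Relation.Unary using (_∈_)

private variable
  a b d e k m n p q r s x y : ℕ
  as bs xs ys st π ρ σ τ : List ℕ

-- Occurrences of patterns as increasing maps

-- For numeric patterns an order isomorphism is the restriction of a function
-- increasing on the entries of τ; this makes occurrences compose freely.
record Occurrence (τ xs : List ℕ) : Set where
  constructor occ
  field
    at   : ℕ → ℕ
    sub  : map at τ ⊑ xs
    mono : a ∈ₗ τ → b ∈ₗ τ → a < b → at a < at b

open Occurrence

lookup-map-cast : ∀ (f : ℕ → ℕ) τ .(eq : length (map f τ) ≡ length τ) i →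
  lookup (map f τ) i ≡ f (lookup τ (cast eq i))
lookup-map-cast f (_ ∷ τ) eq zero    = refl
lookup-map-cast f (_ ∷ τ) eq (suc i) = lookup-map-cast f τ (suc-injective eq) i

≡-map : ∀ (f : ℕ → ℕ) ys τ .(eq : length ys ≡ length τ) →
  (∀ i → lookup ys i ≡ f (lookup τ (cast eq i))) → ys ≡ map f τ
≡-map f []       []      eq h = refl
≡-map f (y ∷ ys) (t ∷ τ) eq h = cong₂ _∷_ (h zero) (≡-map f ys τ (suc-injective eq) (h ∘ suc))

mono⇒reflects : ∀ (f : ℕ → ℕ) → (∀ {a b} → a ∈ₗ τ → b ∈ₗ τ → a < b → f a < f b) →
  a ∈ₗ τ → b ∈ₗ τ → f a < f b → a < b
mono⇒reflects {a = a} {b} f μ a∈ b∈ fa<fb with <-cmp a b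
... | tri< a<b _ _ = a<b
... | tri≈ _ eq _  = contradiction fa<fb (<-irrefl (cong f eq))
... | tri> _ _ b<a = contradiction fa<fb (<-asym (μ b∈ a∈ b<a))

occurrence⇒contains : Occurrence τ xs → xs Contains τ
occurrence⇒contains {τ} (occ f s μ) = map f τ , s , len , λ i j →
  let i∈  = ∈-lookup {xs = τ} (cast len i)
      j∈  = ∈-lookup {xs = τ} (cast len j)
      eqi = lookup-map-cast f τ len i
      eqj = lookup-map-cast f τ len j
  in mk⇔ (mono⇒reflects f μ i∈ j∈ ∘ subst₂ _<_ eqi eqj)
         (subst₂ _<_ (sym eqi) (sym eqj) ∘ μ i∈ j∈)
  where len = length-map f τ

contains⇒occurrence : xs Contains τ → Occurrence τ xs
contains⇒occurrence {xs} {τ} (ys , s , len , iso) = record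
  { at   = f
  ; sub  = subst (_⊑ xs) (≡-map f ys τ len f-lookup) s
  ; mono = f-mono
  }
  where
  f : ℕ → ℕ
  f t with any? (λ i → lookup τ (cast len i) ≟ t)
  ... | yes (i , _) = lookup ys i
  -- The default is arbitrary: `sub` and `mono` evaluate `at` only on entries of `τ`.
  ... | no _        = 0

  f-lookup : ∀ i → lookup ys i ≡ f (lookup τ (cast len i))
  f-lookup i with any? (λ j → lookup τ (cast len j) ≟ lookup τ (cast len i))
  ... | no ∄ = contradiction (i , refl) ∄
  -- The index found may differ from `i`, but a strict comparison in `ys` would force one between
  -- equal entries of `τ`.
  ... | yes (j , eq) with <-cmp (lookup ys i) (lookup ys j)
  ...   | tri≈ _ ≡ _ = ≡
  ...   | tri< lt _ _ = contradiction (Equivalence.to (iso i j) lt) (<-irrefl (sym eq))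
  ...   | tri> _ _ gt = contradiction (Equivalence.to (iso j i) gt) (<-irrefl eq)

  position : a ∈ₗ τ → Σ[ i ∈ Fin (length ys) ] lookup τ (cast len i) ≡ a
  position a∈ = cast (sym len) (index a∈) ,
    trans (cong (lookup τ) (cast-involutive len (sym len) (index a∈))) (sym (lookup-index a∈))

  f-mono : a ∈ₗ τ → b ∈ₗ τ → a < b → f a < f b
  f-mono a∈ b∈ a<b with position a∈ | position b∈
  ... | i , refl | j , refl =
    subst₂ _<_ (f-lookup i) (f-lookup j) (Equivalence.from (iso i j) a<b)

⊑-occurrence : xs ⊑ ys → Occurrence τ xs → Occurrence τ ys
⊑-occurrence xs⊑ys (occ f s μ) = occ f (⊆-trans s xs⊑ys) μ

occurrence⇒length≤ : Occurrence τ xs → length τ ≤ length xs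
occurrence⇒length≤ {τ} (occ f s _) = subst (_≤ _) (length-map f τ) (length-mono-≤ s)

short⇒avoids : length xs < length τ → ¬ Occurrence τ xs
short⇒avoids lt o = <⇒≱ lt (occurrence⇒length≤ o)

hat-occurrence : (o : Occurrence (a ∷ b ∷ τ) xs) →
  at o b ∷ at o a ∷ map (at o) τ ⊑ ys → Occurrence (b ∷ a ∷ τ) ys
hat-occurrence (occ f _ μ) t = occ f t λ u v → μ (unswap u) (unswap v)
  where
  unswap : e ∈ₗ (b ∷ a ∷ τ) → e ∈ₗ (a ∷ b ∷ τ)
  unswap = ∈-resp-↭ (swap _ _ ↭-refl)

-- Since `m` lies below all of `τ`, its image is constrained only to stay below the other images, so
-- any smaller entry in front of them will do.
replace-min : All (m <_) τ → (o : Occurrence (m ∷ τ) xs) →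
  All (y <_) (map (at o) τ) → y ∷ map (at o) τ ⊑ ys → Occurrence (m ∷ τ) ys
replace-min {m} {τ} {y = y} {ys} m<τ (occ f _ μ) y< s = occ g (subst (_⊑ ys) (sym map-g) s) g-mono
  where
  g : ℕ → ℕ
  g e = if does (e ≟ m) then y else f e

  g-m : g m ≡ y
  g-m rewrite dec-true (m ≟ m) refl = refl

  g-τ : m < e → g e ≡ f e
  g-τ {e} m<e rewrite dec-false (e ≟ m) (>⇒≢ m<e) = refl

  map-g : map g (m ∷ τ) ≡ y ∷ map f τ
  map-g = cong₂ _∷_ g-m (map-cong-local (All.map g-τ m<τ))

  g-mono : a ∈ₗ (m ∷ τ) → b ∈ₗ (m ∷ τ) → a < b → g a < g b
  g-mono (here refl) (here refl) a<b = contradiction a<b (<-irrefl refl)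
  g-mono (here refl) (there b∈)  a<b =
    subst₂ _<_ (sym g-m) (sym (g-τ a<b)) (All.lookup y< (∈-map⁺ f b∈))
  g-mono (there a∈)  (here refl) a<b = contradiction a<b (<-asym (All.lookup m<τ a∈))
  g-mono (there a∈)  (there b∈)  a<b =
    subst₂ _<_ (sym (g-τ (All.lookup m<τ a∈))) (sym (g-τ (All.lookup m<τ b∈)))
      (μ (there a∈) (there b∈) a<b)

-- The patterns 21 and 231

occurrence-21 : Occurrence (2 ∷ 1 ∷ []) xs ⇔ ∃₂ λ p q → p ∷ q ∷ [] ⊑ xs × q < p
occurrence-21 {xs} = mk⇔
  (λ (occ f s μ) → f 2 , f 1 , s , μ (there (here refl)) (here refl) ≤-refl)
  (λ (p , q , s , q<p) → occ (g p q) s (g-mono q<p))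
  where
  g : ℕ → ℕ → ℕ → ℕ
  g p q 1 = q
  g p q _ = p
  g-mono : q < p → a ∈ₗ (2 ∷ 1 ∷ []) → b ∈ₗ (2 ∷ 1 ∷ []) → a < b → g p q a < g p q b
  g-mono q<p (here refl) (here refl) (s≤s (s≤s ()))
  g-mono q<p (here refl) (there (here refl)) (s≤s ())
  g-mono q<p (there (here refl)) (here refl) _ = q<p
  g-mono q<p (there (here refl)) (there (here refl)) (s≤s ())

-- Two comparisons determine the pattern, `r < q` being a consequence; this form spares the
-- construction of an increasing map at each use.
Avoids231 : List ℕ → Set
Avoids231 xs = ∀ {p q r} → p ∷ q ∷ r ∷ [] ⊑ xs → p < q → ¬ (r < p)

avoids231⇒avoids : Avoids231 xs → ¬ Occurrence (2 ∷ 3 ∷ 1 ∷ []) xs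
avoids231⇒avoids av (occ f s μ) =
  av s (μ (here refl) (there (here refl)) ≤-refl) (μ (there (there (here refl))) (here refl) ≤-refl)

avoids⇒avoids231 : ¬ Occurrence (2 ∷ 3 ∷ 1 ∷ []) xs → Avoids231 xs
avoids⇒avoids231 av {p} {q} {r} s p<q r<p = av (occ g s g-mono)
  where
  g : ℕ → ℕ
  g 1 = r
  g 2 = p
  g _ = q
  g-mono : a ∈ₗ (2 ∷ 3 ∷ 1 ∷ []) → b ∈ₗ (2 ∷ 3 ∷ 1 ∷ []) → a < b → g a < g b
  g-mono (here refl) (here refl) (s≤s (s≤s ()))
  g-mono (here refl) (there (here refl)) _ = p<q
  g-mono (here refl) (there (there (here refl))) (s≤s ())
  g-mono (there (here refl)) (here refl) (s≤s (s≤s ()))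
  g-mono (there (here refl)) (there (here refl)) (s≤s (s≤s (s≤s ())))
  g-mono (there (here refl)) (there (there (here refl))) (s≤s ())
  g-mono (there (there (here refl))) (here refl) _ = r<p
  g-mono (there (there (here refl))) (there (here refl)) _ = <-trans r<p p<q
  g-mono (there (there (here refl))) (there (there (here refl))) (s≤s ())

⊑-avoids231 : xs ⊑ ys → Avoids231 ys → Avoids231 xs
⊑-avoids231 xs⊑ys av s = av (⊆-trans s xs⊑ys)

-- The increasing map carries a 231 inside `τ` to a 231 inside `xs`.
occurrence-avoids231 : Occurrence τ xs → Avoids231 xs → Avoids231 τ
occurrence-avoids231 (occ f s μ) av t p<q r<p =
  av (⊆-trans (⊑-map⁺ f t) s)
     (μ (⊑-lookup t (here refl)) (⊑-lookup t (there (here refl))) p<q)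
     (μ (⊑-lookup t (there (there (here refl)))) (⊑-lookup t (here refl)) r<p)

-- Sublists of concatenations and relative positions

⊑-++⁻ : ∀ as → xs ⊑ as ++ bs → ∃₂ λ us vs → xs ≡ us ++ vs × us ⊑ as × vs ⊑ bs
⊑-++⁻ []       s          = [] , _ , refl , [] , s
⊑-++⁻ (a ∷ as) (_ ∷ʳ s)   with ⊑-++⁻ as s
... | us , vs , eq , u , v = us , vs , eq , a ∷ʳ u , v
⊑-++⁻ (a ∷ as) (refl ∷ s) with ⊑-++⁻ as s
... | us , vs , eq , u , v = a ∷ us , vs , cong (a ∷_) eq , refl ∷ u , v

-- The leading entry is too large to be taken from `as`, and everything after it must follow it into
-- `bs`.
⊑-++-dropˡ : ∀ as → All (_< m) as → m ≤ x → x ∷ xs ⊑ as ++ bs → x ∷ xs ⊑ bs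
⊑-++-dropˡ as as<m m≤x s with ⊑-++⁻ as s
... | []     , vs , refl , _ , v = v
... | u ∷ us , vs , refl , t , _ with All-resp-⊆ t as<m
...   | u<m ∷ _ = contradiction m≤x (<⇒≱ u<m)

⊑-++-dropʳ : ∀ as → All (m ≤_) bs → All (_< m) xs → xs ⊑ as ++ bs → xs ⊑ as
⊑-++-dropʳ as m≤bs xs<m s with ⊑-++⁻ as s
... | us , []     , refl , t , _ = subst (_⊑ as) (sym (++-identityʳ us)) t
... | us , v ∷ vs , refl , _ , t with All-resp-⊆ t m≤bs | All.++⁻ʳ us xs<m
...   | m≤v ∷ _ | v<m ∷ _ = contradiction m≤v (<⇒≱ v<m)

-- A 231 across the boundary would have `p` in `as` and `r` in `bs`, but `m` separates the two
-- blocks and `r < p`.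
++-avoids231 : ∀ as → All (_≤ m) as → All (m ≤_) bs →
  Avoids231 as → Avoids231 bs → Avoids231 (as ++ bs)
++-avoids231 {m} {bs} as as≤m m≤bs avA avB {p} {q} {r} s p<q r<p = split (⊑-++⁻ as s)
  where
  crossing : p ∈ₗ as → r ∈ₗ bs → ⊥
  crossing p∈ r∈ = <⇒≱ r<p (≤-trans (All.lookup as≤m p∈) (All.lookup m≤bs r∈))

  split : (∃₂ λ us vs → p ∷ q ∷ r ∷ [] ≡ us ++ vs × us ⊑ as × vs ⊑ bs) → ⊥
  split ([] , _ , refl , _ , v)                  = avB v p<q r<p
  split (_ ∷ [] , _ , refl , u , v)              = crossing (to∈ u) (to∈ (∷ˡ⁻ v))
  split (_ ∷ _ ∷ [] , _ , refl , u , v)          =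
    crossing (⊑-lookup u (here refl)) (to∈ v)
  split (_ ∷ _ ∷ _ ∷ [] , [] , refl , u , _)     = avA u p<q r<p

-- These are the two fates of a blocking entry `x`: after `y` it can complete a 231, before `y` it
-- can be put in front of `y ∷ ys` as a new first entry.
∈-position : x ∈ₗ xs → y ∷ ys ⊑ xs → x ≢ y → y ∷ x ∷ [] ⊑ xs ⊎ x ∷ y ∷ ys ⊑ xs
∈-position (here refl) (_ ∷ʳ s)   x≢y = inj₂ (refl ∷ s)
∈-position (here refl) (refl ∷ s) x≢y = contradiction refl x≢y
∈-position (there x∈)  (refl ∷ s) x≢y = inj₁ (refl ∷ from∈ x∈)
∈-position (there x∈)  (z ∷ʳ s)   x≢y with ∈-position x∈ s x≢y
... | inj₁ t = inj₁ (z ∷ʳ t)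
... | inj₂ t = inj₂ (z ∷ʳ t)

-- Runs of the stack as an inductive relation

-- Each move carries the evidence that decides it, so proofs go by induction on the moves instead of
-- on the boolean test in `run`.
data Run (τ : List ℕ) : List ℕ → List ℕ → List ℕ → Set where
  done : Run τ [] st st
  push : ¬ Occurrence τ (x ∷ st) → Run τ π (x ∷ st) ρ → Run τ (x ∷ π) st ρ
  pop  : Occurrence τ (x ∷ s ∷ st) → Run τ (x ∷ π) st ρ → Run τ (x ∷ π) (s ∷ st) (s ∷ ρ)

avoids⇒¬occurrence : xs Avoids τ → ¬ Occurrence τ xs
avoids⇒¬occurrence av o = av (occurrence⇒contains o)

¬occurrence⇒avoids : ¬ Occurrence τ xs → xs Avoids τ
¬occurrence⇒avoids av c = av (contains⇒occurrence c)

run-push : (x ∷ s ∷ st) Avoids τ → run τ (x ∷ π) (s ∷ st) ≡ run τ π (x ∷ s ∷ st)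
run-push {x} {s} {st} {τ} {π} av =
  cong (λ b → if b then run τ π (x ∷ s ∷ st) else s ∷ run τ (x ∷ π) st)
    (dec-true (avoids? (x ∷ s ∷ st) τ) av)

run-pop : ¬ (x ∷ s ∷ st) Avoids τ → run τ (x ∷ π) (s ∷ st) ≡ s ∷ run τ (x ∷ π) st
run-pop {x} {s} {st} {τ} {π} ¬av =
  cong (λ b → if b then run τ π (x ∷ s ∷ st) else s ∷ run τ (x ∷ π) st)
    (dec-false (avoids? (x ∷ s ∷ st) τ) ¬av)

run⇒Run : 2 ≤ length τ → ∀ π st → Run τ π st (run τ π st)
run⇒Run 2≤ []      st = done
-- Here `run` makes no test; the length bound supplies the evidence for the push.
run⇒Run 2≤ (x ∷ π) [] = push (short⇒avoids 2≤) (run⇒Run 2≤ π (x ∷ []))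
run⇒Run {τ} 2≤ (x ∷ π) (s ∷ st) =
  [ (λ av → subst (Run τ _ _) (sym (run-push av))
      (push (avoids⇒¬occurrence av) (run⇒Run 2≤ π (x ∷ s ∷ st))))
  , (λ ¬av → subst (Run τ _ _) (sym (run-pop ¬av))
      (pop (contains⇒occurrence (decidable-stable contains? ¬av)) (run⇒Run 2≤ (x ∷ π) st)))
  ]′ (toSum (avoids? (x ∷ s ∷ st) τ))
  where contains? = anySublist? (λ ys → orderIsomorphic? ys τ) (x ∷ s ∷ st)

Run⇒run : Run τ π st ρ → run τ π st ≡ ρ
Run⇒run done = refl
Run⇒run (push {st = []} _ r) = Run⇒run r
Run⇒run (push {st = s ∷ st} av r) = trans (run-push (¬occurrence⇒avoids av)) (Run⇒run r)
Run⇒run (pop {s = s} o r) =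
  trans (run-pop (λ av → av (occurrence⇒contains o))) (cong (s ∷_) (Run⇒run r))

Run-↭ : Run τ π st ρ → π ++ st ↭ ρ
Run-↭ done = ↭-refl
Run-↭ (push {x = x} {st = st} {π = π} _ r) = ↭-trans (↭-sym (shift x π st)) (Run-↭ r)
Run-↭ (pop {x = x} {s = s} {st = st} {π = π} _ r) =
  ↭-trans (shift s (x ∷ π) st) (prep s (Run-↭ r))

-- Entries on the stack leave from top to bottom; later input is only interleaved with them.
Run-stack : Run τ π st ρ → st ⊑ ρ
Run-stack done       = ⊆-refl
Run-stack (push _ r) = ∷ˡ⁻ (Run-stack r)
Run-stack (pop _ r)  = refl ∷ Run-stack r

Run-input : Run τ π st ρ → x ∈ₗ π → x ∈ₗ ρ
Run-input r x∈ = ∈-resp-↭ (Run-↭ r) (∈-++⁺ˡ x∈)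

-- Knuth: the 21-stack sorts exactly the permutations avoiding 231

AllPairs-⊑ : ∀ {R : ℕ → ℕ → Set} → AllPairs R xs → p ∷ q ∷ [] ⊑ xs → R p q
AllPairs-⊑ (_ ∷ rs) (_ ∷ʳ s)   = AllPairs-⊑ rs s
AllPairs-⊑ (r ∷ _)  (refl ∷ s) = All.lookup r (to∈ s)

-- Pushing `p` above the smaller `s` would create a 21, so `s` leaves before `p` enters and hence
-- before `q` is read.
popped-between : Run (2 ∷ 1 ∷ []) π st ρ →
  s ∈ₗ st → p ∷ q ∷ [] ⊑ π → s < p → s ∷ q ∷ [] ⊑ ρ
popped-between (push av r) s∈ (_ ∷ʳ t)   s<p = popped-between r (there s∈) t s<p
popped-between (push av r) s∈ (refl ∷ t) s<p =
  contradiction (Equivalence.from occurrence-21 (_ , _ , refl ∷ from∈ s∈ , s<p)) av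
popped-between (pop _ r) (here refl) t s<p = refl ∷ from∈ (Run-input r (to∈ (∷ˡ⁻ t)))
popped-between (pop _ r) (there s∈)  t s<p = _ ∷ʳ popped-between r s∈ t s<p

-- Once `p` is on the stack, the larger `q` forces it out before `r` is read. For a 231 this leaves
-- an inversion in the output.
ascent-reverses : Run (2 ∷ 1 ∷ []) π st ρ → p ∷ q ∷ r ∷ [] ⊑ π → p < q → p ∷ r ∷ [] ⊑ ρ
ascent-reverses (push _ r) (_ ∷ʳ t)   p<q = ascent-reverses r t p<q
ascent-reverses (push _ r) (refl ∷ t) p<q = popped-between r (here refl) t p<q
ascent-reverses (pop _ r)  t          p<q = _ ∷ʳ ascent-reverses r t p<q

sorted⇒avoids231 : Run (2 ∷ 1 ∷ []) π st ρ → AllPairs _≤_ ρ → Avoids231 π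
sorted⇒avoids231 r ρ↗ t p<q r<p = <⇒≱ r<p (AllPairs-⊑ ρ↗ (ascent-reverses r t p<q))

-- The induction carries two invariants: the stack increases from the top, and no 231 has its 2 on
-- the stack and its 3 and 1 in the input.
avoids231⇒sorted : Run (2 ∷ 1 ∷ []) π st ρ → AllPairs _≤_ st → Avoids231 π →
  (∀ {s p q} → s ∈ₗ st → p ∷ q ∷ [] ⊑ π → s < p → s ≤ q) → AllPairs _≤_ ρ
avoids231⇒sorted done st↗ av below = st↗
avoids231⇒sorted (push {x = x} avˢ r) st↗ av below =
  avoids231⇒sorted r (x≤st ∷ st↗) (⊑-avoids231 (x ∷ʳ ⊆-refl) av) λ where
    (here refl) t x<p → ≮⇒≥ (av (refl ∷ t) x<p)
    (there s∈)  t s<p → below s∈ (x ∷ʳ t) s<p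
  where
  x≤st = All.tabulate λ s∈ → ≮⇒≥ λ s<x →
    avˢ (Equivalence.from occurrence-21 (_ , _ , refl ∷ from∈ s∈ , s<x))
avoids231⇒sorted (pop {x = x} {s = s} o r) st↗@(s≤st ∷ st′↗) av below =
  -- The popped `s` is at most everything still to come: `x` because it is blocked, later input by
  -- `below`, the rest of the stack by its order.
  All-resp-↭ (Run-↭ r) (<⇒≤ s<x ∷ All.++⁺ (All.tabulate λ z∈ → below (here refl) (refl ∷ from∈ z∈) s<x) s≤st)
    ∷ avoids231⇒sorted r st′↗ av (below ∘ there)
  where
  -- The increasing stack holds no 21, so the larger entry of the blocking 21 is `x`, and its
  -- smaller entry is at least `s`.
  s<x : s < x
  s<x with Equivalence.to occurrence-21 o
  ... | _ , _ , _ ∷ʳ t   , q<p = contradiction q<p (≤⇒≯ (AllPairs-⊑ st↗ t))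
  ... | _ , _ , refl ∷ t , q<x = ≤-<-trans (All.lookup (≤-refl ∷ s≤st) (to∈ t)) q<x

identity-increasing : ∀ n → AllPairs _<_ (identity n)
identity-increasing n = AllPairs.map⁺ (AllPairs.applyUpTo⁺₁ id n λ i<j _ → s≤s i<j)

identity-sorted : ∀ n → AllPairs _≤_ (identity n)
identity-sorted n = AllPairs.map <⇒≤ (identity-increasing n)

sorted↭⇒≡ : AllPairs _≤_ xs → AllPairs _≤_ ys → xs ↭ ys → xs ≡ ys
sorted↭⇒≡ xs↗ ys↗ xs↭ys = Pointwise-≡⇒≡
  (↗↭↗⇒≋ ≤-totalOrder (AllPairs⇒Sorted ≤-totalOrder xs↗) (AllPairs⇒Sorted ≤-totalOrder ys↗) (↭⇒↭ₛ xs↭ys))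

stack-sorts : Avoids231 ρ → ρ ↭ identity n → 𝒮 (2 ∷ 1 ∷ []) ρ ≡ identity n
stack-sorts {ρ} {n} av ρ↭ = sorted↭⇒≡ (avoids231⇒sorted sorting [] av λ ()) (identity-sorted n)
  (↭-trans (↭-sym (Run-↭ sorting)) (↭-trans (↭-reflexive (++-identityʳ ρ)) ρ↭))
  where sorting = run⇒Run ≤-refl ρ []

-- Effectiveness when 1 is first, third or later

-- Knuth's theorem turns sortability into avoidance of 231 by the output, the only form in which the
-- second stack enters the proofs of effectiveness.
effective : 2 ≤ length σ →
  (∀ {π ρ} → Run σ π [] ρ → Avoids231 ρ → ¬ Occurrence σ ρ) → Effective σ
effective {σ} 2≤ avoids {ρ} (π , (n , 1≤n , π↭ , sorts) , refl) =
  (n , 1≤n , ↭-trans (↭-sym (Run-↭ r₁)) (↭-trans (↭-reflexive (++-identityʳ π)) π↭)) ,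
  ¬occurrence⇒avoids (avoids r₁ (sorted⇒avoids231 r₂ (subst (AllPairs _≤_) (sym sorts) (identity-sorted n))))
  where
  r₁ = run⇒Run 2≤ π []
  r₂ = run⇒Run {τ = 2 ∷ 1 ∷ []} ≤-refl (𝒮 σ π) []

-- The last pop before x is pushed removes the second entry of an occurrence
-- starting with x, and both precede the remaining entries in the output.
blocked⇒hat : Run (a ∷ b ∷ τ) (x ∷ π) st ρ → ¬ Occurrence (a ∷ b ∷ τ) st →
  Occurrence (a ∷ b ∷ τ) (x ∷ st) → Occurrence (b ∷ a ∷ τ) ρ
blocked⇒hat (push avˢ _) av o = contradiction o avˢ
blocked⇒hat (pop _ r) av (occ f (_ ∷ʳ t) μ) = contradiction (occ f t μ) av
blocked⇒hat (pop _ (pop o r)) av (occ f (refl ∷ _) μ) =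
  ⊑-occurrence (_ ∷ʳ ⊆-refl)
    (blocked⇒hat (pop o r) (av ∘ ⊑-occurrence (_ ∷ʳ ⊆-refl)) o)
blocked⇒hat (pop _ (push avˢ r)) av (occ f (refl ∷ _ ∷ʳ t) μ) =
  contradiction (occ f (refl ∷ t) μ) avˢ
blocked⇒hat (pop _ (push avˢ r)) av (occ f (refl ∷ refl ∷ t) μ) =
  hat-occurrence (occ f (refl ∷ refl ∷ t) μ) (refl ∷ ⊆-trans (refl ∷ t) (Run-stack r))

-- Without a pop during reading, the output is the final stack, which avoids the pattern; otherwise
-- the first pop already yields the second alternative.
avoids-or-hat : Run (a ∷ b ∷ τ) π st ρ → ¬ Occurrence (a ∷ b ∷ τ) st →
  ¬ Occurrence (a ∷ b ∷ τ) ρ ⊎ Occurrence (b ∷ a ∷ τ) ρ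
avoids-or-hat done        av = inj₁ av
avoids-or-hat (push avˢ r) av = avoids-or-hat r avˢ
avoids-or-hat (pop o r)   av = inj₂ (blocked⇒hat (pop o r) av o)

-- If `ρ` contained the pattern it would contain its hat too. Whichever of the two starts with an
-- ascent has a 231 formed by that ascent and the later 1.
later-min-avoids : 1 ∈ₗ τ → 1 < a → 1 < b → a ≢ b →
  Run (a ∷ b ∷ τ) π [] ρ → Avoids231 ρ → ¬ Occurrence (a ∷ b ∷ τ) ρ
later-min-avoids {a = a} {b} 1∈ 1<a 1<b a≢b r av o with avoids-or-hat r (short⇒avoids z<s)
... | inj₁ avρ = avρ o
... | inj₂ h with <-cmp a b
...   | tri< a<b _ _ = occurrence-avoids231 o av (refl ∷ refl ∷ from∈ 1∈) a<b 1<a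
...   | tri≈ _ a≡b _ = a≢b a≡b
...   | tri> _ _ b<a = occurrence-avoids231 h av (refl ∷ refl ∷ from∈ 1∈) b<a 1<b

min-below : All (m <_) τ → (o : Occurrence (m ∷ τ) xs) → All (at o m <_) (map (at o) τ)
min-below m< (occ g _ ν) =
  All.map⁺ (All.tabulate λ e∈ → ν (here refl) (there e∈) (All.lookup m< e∈))

-- As the stack avoids the pattern, `x` must play `m`. Either `s` plays `b`, which is larger, or `s`
-- is skipped; in that case `s ≤ x` would let `s` play `m` instead, inside the stack.
blocker-below : All (m <_) (b ∷ τ) → ¬ Occurrence (m ∷ b ∷ τ) (s ∷ st) →
  Occurrence (m ∷ b ∷ τ) (x ∷ s ∷ st) → x < s
blocker-below m< av (occ g (_ ∷ʳ u) ν) = contradiction (occ g u ν) av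
blocker-below m< av (occ g (refl ∷ refl ∷ u) ν) = ν (here refl) (there (here refl)) (All.head m<)
blocker-below m< av o@(occ g (refl ∷ _ ∷ʳ u) ν) = ≰⇒> λ s≤x →
  av (replace-min m< o (All.map (≤-<-trans s≤x) (min-below m< o)) (refl ∷ u))

-- When x replaces the popped entry s, the new occurrence lies in the output
-- produced after s, which is what makes the induction on the run work.
first-min-avoids : All (m <_) (b ∷ τ) → Run (m ∷ b ∷ τ) π st ρ → ¬ Occurrence (m ∷ b ∷ τ) st →
  Avoids231 ρ → ¬ Occurrence (m ∷ b ∷ τ) ρ
first-min-avoids m< done        av avρ o = av o
first-min-avoids m< (push avˢ r) av avρ o = first-min-avoids m< r avˢ avρ o
first-min-avoids m< (pop _ r)   av avρ (occ f (_ ∷ʳ t) μ) =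
  first-min-avoids m< r (av ∘ ⊑-occurrence (_ ∷ʳ ⊆-refl)) (⊑-avoids231 (_ ∷ʳ ⊆-refl) avρ) (occ f t μ)
first-min-avoids m< (pop oₓ r) av avρ o@(occ f (refl ∷ t) μ)
  with ∈-position (Run-input r (here refl)) t
         (<⇒≢ (<-trans (blocker-below m< av oₓ) (μ (here refl) (there (here refl)) (All.head m<))))
... | inj₁ u = avρ (refl ∷ u) (μ (here refl) (there (here refl)) (All.head m<)) (blocker-below m< av oₓ)
... | inj₂ u = first-min-avoids m< r (av ∘ ⊑-occurrence (_ ∷ʳ ⊆-refl)) (⊑-avoids231 (_ ∷ʳ ⊆-refl) avρ)
  (replace-min m< o (All.map (<-trans (blocker-below m< av oₓ)) (min-below m< o)) u)

-- Identity permutations and shifted lists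

identity-positive : ∀ n → All (1 ≤_) (identity n)
identity-positive n = All.map⁺ (All.universal (λ _ → s≤s z≤n) (upTo n))

identity-≤ : ∀ n → All (_≤ n) (identity n)
identity-≤ n = All.map⁺ (All.applyUpTo⁺₁ id n id)

applyUpTo-+ : ∀ (f : ℕ → ℕ) m n → applyUpTo f (m + n) ≡ applyUpTo f m ++ applyUpTo (f ∘ (m +_)) n
applyUpTo-+ f zero    n = refl
applyUpTo-+ f (suc m) n = cong (f 0 ∷_) (applyUpTo-+ (f ∘ suc) m n)

identity-+ : ∀ m n → identity (m + n) ≡ identity m ++ map (_+ m) (identity n)
identity-+ m n = begin
  map suc (upTo (m + n))                             ≡⟨ cong (map suc) (applyUpTo-+ id m n) ⟩
  map suc (upTo m ++ applyUpTo (m +_) n)             ≡⟨ map-++ suc (upTo m) _ ⟩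
  identity m ++ map suc (applyUpTo (m +_) n)         ≡⟨ cong (λ xs → identity m ++ map suc xs) (map-upTo (m +_) n) ⟨
  identity m ++ map suc (map (m +_) (upTo n))        ≡⟨ cong (identity m ++_) (map-∘ (upTo n)) ⟨
  identity m ++ map (λ i → 1 + (m + i)) (upTo n)
    ≡⟨ cong (identity m ++_) (map-cong (λ i → cong suc (+-comm m i)) (upTo n)) ⟩
  identity m ++ map ((_+ m) ∘ suc) (upTo n)          ≡⟨ cong (identity m ++_) (map-∘ (upTo n)) ⟩
  identity m ++ map (_+ m) (identity n)              ∎
  where open ≡-Reasoning

⊑-map⁻ : ∀ (f : ℕ → ℕ) ys → xs ⊑ map f ys → ∃[ zs ] xs ≡ map f zs × zs ⊑ ys
⊑-map⁻ f []       []         = [] , refl , []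
⊑-map⁻ f (y ∷ ys) (_ ∷ʳ s)   with ⊑-map⁻ f ys s
... | zs , eq , t = zs , eq , y ∷ʳ t
⊑-map⁻ f (y ∷ ys) (refl ∷ s) with ⊑-map⁻ f ys s
... | zs , eq , t = y ∷ zs , cong (f y ∷_) eq , refl ∷ t

map-avoids231 : ∀ (f : ℕ → ℕ) → (∀ {a b} → f a < f b → a < b) → Avoids231 xs → Avoids231 (map f xs)
map-avoids231 {xs} f reflects av s p<q r<p with ⊑-map⁻ f xs s
... | _ ∷ _ ∷ _ ∷ [] , refl , t = av t (reflects p<q) (reflects r<p)

-- Ineffectiveness when 1 is second

-- The stack as blocks 1 L | a + d, L + d, H + d, where d + 1 = a: the first
-- block is too short for the part a 1 L of the pattern, the second for the
-- whole of it.
blocks-avoid : All (_< suc d) (1 ∷ as) → All (1 ≤_) (suc d ∷ as ++ bs) →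
  ¬ Occurrence (suc d ∷ 1 ∷ as ++ bs) (1 ∷ as ++ map (_+ d) (suc d ∷ as ++ bs))
blocks-avoid {d} {as} {bs} as< pos o@(occ f s μ) with f (suc d) <? suc d
... | yes f< = <⇒≱ ≤-refl (subst (_≤ length (1 ∷ as)) (length-map f (suc d ∷ 1 ∷ as))
    (length-mono-≤ (⊑-++-dropʳ (1 ∷ as) shifted-≥ below prefix)))
  where
  shifted-≥ : All (suc d ≤_) (map (_+ d) (suc d ∷ as ++ bs))
  shifted-≥ = All.map⁺ (All.map (+-monoˡ-≤ d) pos)

  prefix : map f (suc d ∷ 1 ∷ as) ⊑ 1 ∷ as ++ map (_+ d) (suc d ∷ as ++ bs)
  prefix = ⊆-trans (⊑-map⁺ f (⊑-++⁺ʳ {as = suc d ∷ 1 ∷ as} bs ⊆-refl)) s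

  below : All (_< suc d) (map f (suc d ∷ 1 ∷ as))
  below = f< ∷ All.map⁺ (All.tabulate λ e∈ →
    <-trans (μ (there (∈-++⁺ˡ e∈)) (here refl) (All.lookup as< e∈)) f<)
... | no f≮ = short⇒avoids (s≤s (≤-reflexive (length-map (_+ d) (suc d ∷ as ++ bs))))
  (occ f (⊑-++-dropˡ (1 ∷ as) as< (≮⇒≥ f≮) s) μ)

-- Only the tallest stack needs checking, since each earlier one is a sublist of it. The input has
-- `xs` reversed so that `xs` reads from the top down.
push-all : ∀ xs → ¬ Occurrence τ (xs ++ st) → Run τ π (xs ++ st) ρ → Run τ (xs ʳ++ π) st ρ
push-all []       av r = r
push-all (x ∷ xs) av r = push-all xs (av ∘ ⊑-occurrence (x ∷ʳ ⊆-refl)) (push av r)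

-- d is the number of entries of σ below its first entry.
module Counterexample {d as bs k} (1≤d : 1 ≤ d)
  (as≤d : All (_< suc d) as) (bs>d : All (suc d <_) bs)
  (σ↭ : suc d ∷ 1 ∷ as ++ bs ↭ identity k) (σ-avoids : Avoids231 (suc d ∷ 1 ∷ as ++ bs))
  where

  pattern-σ input output : List ℕ
  pattern-σ = suc d ∷ 1 ∷ as ++ bs
  -- Three stages: `suc d` comes to rest on top of the shifted entries, `suc d + d` forces it out
  -- and takes its place, and `1 ∷ as` is then stacked above.
  input  = (suc d ∷ map (_+ d) (as ++ bs)) ʳ++ (suc d + d ∷ (1 ∷ as) ʳ++ [])
  output = (suc d ∷ 1 ∷ as) ++ map (_+ d) (suc d ∷ as ++ bs)

  positive : All (1 ≤_) pattern-σ
  positive = All-resp-↭ (↭-sym σ↭) (identity-positive k)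

  first-positive : All (1 ≤_) (suc d ∷ as ++ bs)
  first-positive = All.head positive ∷ All.tail (All.tail positive)

  low : All (_< suc d) (1 ∷ as)
  low = s≤s 1≤d ∷ as≤d

  short : ∀ {xs} → length xs ≡ length (as ++ bs) → ¬ Occurrence pattern-σ (x ∷ xs)
  short eq = short⇒avoids (s≤s (s≤s (≤-reflexive eq)))

  process : Run pattern-σ input [] output
  process =
    push-all (suc d ∷ upper) (subst (¬_ ∘ Occurrence pattern-σ) (sym (++-identityʳ _)) (short len))
      (subst (λ st → Run pattern-σ (suc d + d ∷ (1 ∷ as) ʳ++ []) st output) (sym (++-identityʳ (suc d ∷ upper)))
        (pop blocked (push (short len) (push-all (1 ∷ as) (blocks-avoid low first-positive) done))))
    where
    upper = map (_+ d) (as ++ bs)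
    len   = length-map (_+ d) (as ++ bs)

    -- The shift is `d` because `1 + d` is `suc d`: the entry on top of the stack plays the 1 of the
    -- shifted pattern.
    blocked : Occurrence pattern-σ (map (_+ d) pattern-σ)
    blocked = occ (_+ d) ⊆-refl λ _ _ → +-monoˡ-< d

  d≤k : d ≤ k
  d≤k = <⇒≤ (All.lookup (identity-≤ k) (∈-resp-↭ σ↭ (here refl)))

  -- The entries of `pattern-σ` below `suc d` are those of `1 ∷ as`; the same filter applied to the
  -- identity leaves its first `d` entries.
  low↭ : 1 ∷ as ↭ identity d
  low↭ = begin
    1 ∷ as                                         ≡⟨ ++-identityʳ (1 ∷ as) ⟨
    (1 ∷ as) ++ []                                 ≡⟨ cong₂ _++_ (filter-all <a? low) (filter-none <a? (All.map <-asym bs>d)) ⟨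
    filter <a? (1 ∷ as) ++ filter <a? bs           ≡⟨ filter-++ <a? (1 ∷ as) bs ⟨
    filter <a? ((1 ∷ as) ++ bs)                    ≡⟨ filter-reject <a? (n≮n (suc d)) ⟨
    filter <a? pattern-σ                           ↭⟨ filter-↭ <a? σ↭ ⟩
    filter <a? (identity k)                        ≡⟨ cong (filter <a? ∘ identity) (m+[n∸m]≡n d≤k) ⟨
    filter <a? (identity (d + (k ∸ d)))            ≡⟨ cong (filter <a?) (identity-+ d (k ∸ d)) ⟩
    filter <a? (identity d ++ map (_+ d) (identity (k ∸ d)))
      ≡⟨ filter-++ <a? (identity d) _ ⟩
    filter <a? (identity d) ++ filter <a? (map (_+ d) (identity (k ∸ d)))
      ≡⟨ cong₂ _++_ (filter-all <a? (All.map s≤s (identity-≤ d)))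
           (filter-none <a? (All.map⁺ (All.map (λ 1≤e → ≤⇒≯ (+-monoˡ-≤ d 1≤e)) (identity-positive (k ∸ d))))) ⟩
    identity d ++ []                               ≡⟨ ++-identityʳ _ ⟩
    identity d                                     ∎
    where
    open PermutationReasoning
    <a? = _<? suc d

  output↭ : output ↭ identity (d + k)
  output↭ = begin
    suc d ∷ (1 ∷ as) ++ map (_+ d) (suc d ∷ as ++ bs)   ↭⟨ shift (suc d) (1 ∷ as) _ ⟨
    -- The leading `suc d` is `1 + d`, the one entry missing from the shifted copy of `pattern-σ`.
    (1 ∷ as) ++ suc d ∷ map (_+ d) (suc d ∷ as ++ bs)   ↭⟨ ↭-++⁺ˡ (1 ∷ as) (swap _ _ ↭-refl) ⟩
    (1 ∷ as) ++ map (_+ d) pattern-σ                    ↭⟨ ↭-++⁺ low↭ (↭-map⁺ (_+ d) σ↭) ⟩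
    identity d ++ map (_+ d) (identity k)               ≡⟨ identity-+ d k ⟨
    identity (d + k)                                    ∎
    where open PermutationReasoning

  -- The value `suc d` separates the two halves, and each half is a sublist of `pattern-σ`, the
  -- second one shifted.
  output-avoids : Avoids231 output
  output-avoids = ++-avoids231 (suc d ∷ 1 ∷ as)
    (≤-refl ∷ All.map <⇒≤ low) (All.map⁺ (All.map (+-monoˡ-≤ d) first-positive))
    (⊑-avoids231 (⊑-++⁺ʳ bs ⊆-refl) σ-avoids)
    (map-avoids231 (_+ d) (+-cancelʳ-< d _ _) (⊑-avoids231 (refl ∷ 1 ∷ʳ ⊆-refl) σ-avoids))

  output-contains : Occurrence pattern-σ output
  output-contains = occ f (subst (_⊑ output) (sym map-f) sublist) λ _ _ → f-mono
    where
    -- The entries up to `suc d` are found in the first half of the output, those of `bs` in the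
    -- shifted half.
    f : ℕ → ℕ
    f e = if does (e ≤? suc d) then e else e + d

    f-low : e ≤ suc d → f e ≡ e
    f-low {e} e≤ = cong (λ b → if b then e else e + d) (dec-true (e ≤? suc d) e≤)

    f-high : suc d < e → f e ≡ e + d
    f-high {e} e> = cong (λ b → if b then e else e + d) (dec-false (e ≤? suc d) (<⇒≱ e>))

    map-f : map f pattern-σ ≡ (suc d ∷ 1 ∷ as) ++ map (_+ d) bs
    map-f = trans (map-++ f (suc d ∷ 1 ∷ as) bs)
      (cong₂ _++_ (map-id-local (f-low ≤-refl ∷ All.map (f-low ∘ <⇒≤) low))
        (map-cong-local (All.map f-high bs>d)))

    sublist : (suc d ∷ 1 ∷ as) ++ map (_+ d) bs ⊑ output
    sublist = ⊑-++⁺ {as = suc d ∷ 1 ∷ as} ⊆-refl (⊑-map⁺ (_+ d) (⊑-++⁺ˡ (suc d ∷ as) ⊆-refl))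

    f-mono : a < b → f a < f b
    f-mono {a} {b} a<b with a ≤? suc d | b ≤? suc d
    ... | yes a≤ | yes b≤ = subst₂ _<_ (sym (f-low a≤)) (sym (f-low b≤)) a<b
    ... | yes a≤ | no b≰  = subst₂ _<_ (sym (f-low a≤)) (sym (f-high (≰⇒> b≰))) (<-≤-trans a<b (m≤m+n b d))
    ... | no a≰  | yes b≤ = contradiction (≤-trans (<⇒≤ a<b) b≤) a≰
    ... | no a≰  | no b≰  =
      subst₂ _<_ (sym (f-high (≰⇒> a≰))) (sym (f-high (≰⇒> b≰))) (+-monoˡ-< d a<b)

  ineffective : ¬ Effective pattern-σ
  ineffective eff = proj₂ (eff sorted) (occurrence⇒contains output-contains)
    where
    input↭ : input ↭ identity (d + k)
    input↭ = ↭-trans (↭-reflexive (sym (++-identityʳ input))) (↭-trans (Run-↭ process) output↭)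

    sorted : output ∈ Sorted pattern-σ
    sorted = input
      , (d + k , ≤-trans 1≤d (m≤m+n d k) , input↭
        , trans (cong (𝒮 (2 ∷ 1 ∷ [])) (Run⇒run process)) (stack-sorts output-avoids output↭))
      , sym (Run⇒run process)

-- The equivalence, by the position of 1

-- After the first entry above `a`, an entry below `a` would complete a 231.
avoids231⇒split : ∀ xs → Avoids231 (a ∷ xs) → All (a ≢_) xs →
  ∃₂ λ as bs → xs ≡ as ++ bs × All (_< a) as × All (a <_) bs
avoids231⇒split [] _ _ = [] , [] , refl , [] , []
avoids231⇒split {a} (x ∷ xs) av (a≢x ∷ a≢) with x <? a
... | no x≮a = [] , x ∷ xs , refl , [] , a<x ∷ All.tabulate λ z∈ →
    ≤∧≢⇒< (≮⇒≥ (av (refl ∷ refl ∷ from∈ z∈) a<x)) (All.lookup a≢ z∈)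
  where a<x = ≤∧≢⇒< (≮⇒≥ x≮a) a≢x
... | yes x<a with avoids231⇒split xs (⊑-avoids231 (refl ∷ x ∷ʳ ⊆-refl) av) a≢
...   | as , bs , eq , as< , bs> = x ∷ as , bs , cong (x ∷_) eq , x<a ∷ as< , bs>

-- The inserted 1 cannot be the 2, as nothing is smaller, nor the 3, as `a` is not below it, nor the
-- 1, as only `a` precedes it.
insert-1-avoids231 : 1 ≤ a → All (1 ≤_) xs → Avoids231 (a ∷ xs) → Avoids231 (a ∷ 1 ∷ xs)
insert-1-avoids231 1≤a pos av (_ ∷ʳ _ ∷ʳ s) = av (_ ∷ʳ s)
insert-1-avoids231 1≤a pos av (_ ∷ʳ refl ∷ s) _ r<1 =
  <⇒≱ r<1 (All.lookup pos (to∈ (∷ˡ⁻ s)))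
insert-1-avoids231 1≤a pos av (refl ∷ _ ∷ʳ s) = av (refl ∷ s)
insert-1-avoids231 1≤a pos av (refl ∷ refl ∷ s) a<1 = contradiction 1≤a (<⇒≱ a<1)

↭identity-unique : xs ↭ identity n → AllPairs _≢_ xs
↭identity-unique {n = n} xs↭ =
  Permutationₛ.Unique-resp-↭ (setoid ℕ) (↭⇒↭ₛ (↭-sym xs↭)) (AllPairs.map <⇒≢ (identity-increasing n))

↭identity-positive : xs ↭ identity n → All (1 ≤_) xs
↭identity-positive {n = n} xs↭ = All-resp-↭ (↭-sym xs↭) (identity-positive n)

second-min-ineffective : ∀ xs → 1 ≤ d → suc d ∷ 1 ∷ xs ↭ identity k →
  Avoids231 (suc d ∷ 1 ∷ xs) → ¬ Effective (suc d ∷ 1 ∷ xs)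
second-min-ineffective xs 1≤d σ↭ av
  with avoids231⇒split xs (⊑-avoids231 (refl ∷ 1 ∷ʳ ⊆-refl) av)
         (All.tail (AllPairs.head (↭identity-unique σ↭)))
... | as , bs , refl , as< , bs> = Counterexample.ineffective 1≤d as< bs> σ↭ av

1⊕⇒ineffective : ∀ {α} σ → σ ∈ Sym → α ∈ Sym⟨ 2 ∷ 3 ∷ 1 ∷ [] ⟩ → hat σ ≡ 1⊕ α → ¬ Effective σ
1⊕⇒ineffective {[]} _ _ ((n , 1≤n , α↭) , _) _ =
  contradiction (↭-length α↭) (<⇒≢ (subst (1 ≤_) (sym (trans (length-map suc (upTo n)) (length-upTo n))) 1≤n))
1⊕⇒ineffective {_ ∷ _} (_ ∷ []) _ _ ()
-- The equation forces the permutation to be `suc d ∷ 1 ∷ map suc α`, so the first entry of the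
-- given summand is the shift `d` of the counterexample.
1⊕⇒ineffective {d ∷ α} (_ ∷ _ ∷ _) (k , _ , σ↭) ((n , _ , α↭) , α-av) refl =
  second-min-ineffective (map suc α) (All.head (↭identity-positive α↭)) σ↭
    (insert-1-avoids231 (s≤s z≤n) (All.map⁺ (All.universal (λ _ → s≤s z≤n) α))
      (map-avoids231 suc s<s⁻¹ (avoids⇒avoids231 (avoids⇒¬occurrence α-av))))

first-min-effective : 1 ∷ a ∷ τ ↭ identity k → Effective (1 ∷ a ∷ τ)
first-min-effective σ↭ = effective (s≤s (s≤s z≤n)) λ r →
  first-min-avoids 1<τ r (short⇒avoids z<s)
  where
  1<τ = All.zipWith (λ (1≤e , 1≢e) → ≤∧≢⇒< 1≤e 1≢e)
    (All.tail (↭identity-positive σ↭) , AllPairs.head (↭identity-unique σ↭))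

later-min-effective : a ∷ b ∷ τ ∈ Sym → a ≢ 1 → b ≢ 1 → Effective (a ∷ b ∷ τ)
later-min-effective {a} {b} {τ} (suc k , _ , σ↭) a≢1 b≢1
  with ↭identity-positive σ↭ | ↭identity-unique σ↭ | ∈-resp-↭ (↭-sym σ↭) (here refl)
... | _ | _ | here 1≡a         = contradiction (sym 1≡a) a≢1
... | _ | _ | there (here 1≡b) = contradiction (sym 1≡b) b≢1
... | 1≤a ∷ 1≤b ∷ _ | (a≢b ∷ _) ∷ _ | there (there 1∈τ) = effective (s≤s (s≤s z≤n))
  (later-min-avoids 1∈τ (≤∧≢⇒< 1≤a (≢-sym a≢1)) (≤∧≢⇒< 1≤b (≢-sym b≢1)) a≢b)

1⊕-Sym : ∀ {α} → 1 ≤ length α → 1⊕ α ∈ Sym → α ∈ Sym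
1⊕-Sym {α} 1≤α (suc k , _ , σ↭) = k , subst (1 ≤_) length≡k 1≤α , α↭
  where
  α↭ : α ↭ identity k
  α↭ = begin
    α                                     ≡⟨ map-pred α ⟨
    map pred (map suc α)                  ↭⟨ ↭-map⁺ pred (drop-∷ σ↭) ⟩
    map pred (map suc (applyUpTo suc k))  ≡⟨ map-pred (applyUpTo suc k) ⟩
    applyUpTo suc k                       ≡⟨ map-upTo suc k ⟨
    identity k                            ∎
    where
    open PermutationReasoning
    map-pred : ∀ xs → map pred (map suc xs) ≡ xs
    map-pred xs = trans (sym (map-∘ xs)) (map-id xs)

  length≡k : length α ≡ k
  length≡k = trans (↭-length α↭) (trans (length-map suc (upTo k)) (length-upTo k))

-- Deleting the 1 and lowering the rest gives `α`. A 231 in `α` would appear in every output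
-- containing the pattern, so no output avoiding 231 could contain it and the pattern would be
-- effective.
second-min-1⊕ : a ∷ 1 ∷ τ ∈ Sym → ¬ Effective (a ∷ 1 ∷ τ) →
  ∃[ α ] (α ∈ Sym⟨ 2 ∷ 3 ∷ 1 ∷ [] ⟩ × 1 ∷ a ∷ τ ≡ 1⊕ α)
second-min-1⊕ {a} {τ} σ∈@(n , 1≤n , σ↭) ¬eff with ↭identity-positive σ↭
... | 1≤a ∷ _ ∷ 1≤τ = α , (α∈ , ¬occurrence⇒avoids α-avoids) , cong (1 ∷_) aτ≡
  where
  α = map pred (a ∷ τ)

  aτ≡ : a ∷ τ ≡ map suc α
  aτ≡ = sym (trans (sym (map-∘ (a ∷ τ)))
    (map-id-local (All.map (λ 1≤e → suc-pred _ {{>-nonZero 1≤e}}) (1≤a ∷ 1≤τ))))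

  α∈ : α ∈ Sym
  α∈ = 1⊕-Sym (s≤s z≤n) (subst (λ xs → 1 ∷ xs ∈ Sym) aτ≡ (n , 1≤n , ↭-trans (swap _ _ ↭-refl) σ↭))

  α-in-σ : Occurrence α (a ∷ 1 ∷ τ)
  α-in-σ = ⊑-occurrence (refl ∷ 1 ∷ʳ ⊆-refl)
    (occ suc (⊆-reflexive (sym aτ≡)) λ _ _ → s≤s)

  α-avoids : ¬ Occurrence (2 ∷ 3 ∷ 1 ∷ []) α
  α-avoids o = ¬eff (effective (s≤s (s≤s z≤n)) λ r av oσ →
    avoids231⇒avoids (occurrence-avoids231 α-in-σ (occurrence-avoids231 oσ av)) o)

ineffective⇒1⊕ : ∀ σ → σ ∈ Sym → 2 ≤ length σ → ¬ Effective σ →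
  ∃[ α ] (α ∈ Sym⟨ 2 ∷ 3 ∷ 1 ∷ [] ⟩ × hat σ ≡ 1⊕ α)
ineffective⇒1⊕ (_ ∷ []) _ (s≤s ())
ineffective⇒1⊕ (a ∷ b ∷ τ) σ∈@(_ , _ , σ↭) _ ¬eff with b ≟ 1 | a ≟ 1
... | yes refl | _        = second-min-1⊕ σ∈ ¬eff
... | no _     | yes refl = ⊥-elim (¬eff (first-min-effective σ↭))
... | no b≢1   | no a≢1   = ⊥-elim (¬eff (later-min-effective σ∈ a≢1 b≢1))

corollary11 : (σ : List ℕ) → σ ∈ Sym → 2 ≤ length σ →
    (¬ Effective σ) ⇔ (∃[ α ] (α ∈ Sym⟨ 2 ∷ 3 ∷ 1 ∷ [] ⟩ × hat σ ≡ 1⊕ α))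
corollary11 σ σ∈ 2≤ = mk⇔ (ineffective⇒1⊕ σ σ∈ 2≤)
  (λ (α , α∈ , hat≡) → 1⊕⇒ineffective σ σ∈ α∈ hat≡)
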